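{- Let $q=3^d$ with $d$ odd, and consider the elliptic curve $E\colon y^2=x^3+x$ over $\mathbb{F}_q$. Then $\#E(\mathbb{F}_q)=q+1$.
   Context: $\#E(\mathbb{F}_q)$ counts all $\mathbb{F}_q$-rational points, including the point at infinity. -}

module Defs where

open import Algebra using (CommutativeRing)
open import Algebra.Apartness using (HeytingField)
open import Data.Fin using (Fin)
open import Data.Fin.Permutation using (Permutation′; permutation; _⟨$⟩ʳ_)
open import Data.Nat as ℕ using (ℕ; zero; suc)
open import Data.Nat.Solver using (module +-*-Solver)
open import Data.Product using (∃-syntax; _,_)
open import Function using (Inverse; _∘_)
open import Level using (Level; _⊔_)
open import Relation.Binary using (Setoid)
open import Relation.Binary.PropositionalEquality as ≡ using (_≡_)
import Algebra.Apartness.Properties.HeytingCommutativeRing as HCRProperties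
import Algebra.Properties.CommutativeMonoid.Sum as Sum
import Algebra.Properties.Ring as RingProperties
import Algebra.Properties.Semiring.Exp as Exp
import Algebra.Properties.Semiring.Mult as Mult
import Relation.Binary.Reasoning.Setoid as ≈-Reasoning

private
  variable
    c ℓ₁ ℓ₂ : Level

-- Elements are counted up to the setoid equality.
HasCardinality : Setoid c ℓ₁ → ℕ → Set (c ⊔ ℓ₁)
HasCardinality S n = Inverse S (≡.setoid (Fin n))

fieldRing : HeytingField c ℓ₁ ℓ₂ → CommutativeRing c ℓ₁
fieldRing F = record { isCommutativeRing = HeytingField.isCommutativeRing F }

module _ (F : HeytingField c ℓ₁ ℓ₂) where
  open HeytingField F
  open CommutativeRing (fieldRing F) using (semiring)
  open Mult semiring using (_×_)
  open Exp semiring using (_^_)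

  -- The plane cubic y² + a₁xy + a₃y = x³ + a₂x² + a₄x + a₆.
  record WeierstrassCurve : Set c where
    field
      a₁ a₂ a₃ a₄ a₆ : Carrier

    b₂ b₄ b₆ b₈ Δ : Carrier
    b₂ = a₁ ^ 2 + 4 × a₂
    b₄ = 2 × a₄ + a₁ * a₃
    b₆ = a₃ ^ 2 + 4 × a₆
    b₈ = a₁ ^ 2 * a₆ + 4 × (a₂ * a₆) - a₁ * a₃ * a₄ + a₂ * a₃ ^ 2 - a₄ ^ 2
    Δ  = - (b₂ ^ 2 * b₈) - 8 × (b₄ ^ 3) - 27 × (b₆ ^ 2) + 9 × (b₂ * b₄ * b₆)

    OnCurve : Carrier → Carrier → Set ℓ₁
    OnCurve x y =
      y ^ 2 + a₁ * x * y + a₃ * y ≈ x ^ 3 + a₂ * x ^ 2 + a₄ * x + a₆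

  record EllipticCurve : Set (c ⊔ ℓ₂) where
    field
      weierstrassCurve : WeierstrassCurve

    open WeierstrassCurve weierstrassCurve public

    field
      Δ#0 : Δ # 0#

-- The rational points of the projective closure: it meets the line at
-- infinity in the single point (0 : 1 : 0).
module _ {F : HeytingField c ℓ₁ ℓ₂} (E : EllipticCurve F) where
  open HeytingField F
  open EllipticCurve E

  data Point : Set (c ⊔ ℓ₁) where
    ∞      : Point
    affine : (x y : Carrier) → OnCurve x y → Point

  data _≈ₚ_ : Point → Point → Set (c ⊔ ℓ₁) where
    ∞≈∞    : ∞ ≈ₚ ∞
    affine : ∀ {x y x′ y′ p p′} → x ≈ x′ → y ≈ y′ → affine x y p ≈ₚ affine x′ y′ p′

  pointSetoid : Setoid (c ⊔ ℓ₁) (c ⊔ ℓ₁)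
  pointSetoid = record
    { Carrier       = Point
    ; _≈_           = _≈ₚ_
    ; isEquivalence = record { refl = reflₚ ; sym = symₚ ; trans = transₚ }
    }
    where
    reflₚ : ∀ {P} → P ≈ₚ P
    reflₚ {∞}            = ∞≈∞
    reflₚ {affine _ _ _} = affine refl refl

    symₚ : ∀ {P Q} → P ≈ₚ Q → Q ≈ₚ P
    symₚ ∞≈∞          = ∞≈∞
    symₚ (affine p q) = affine (sym p) (sym q)

    transₚ : ∀ {P Q R} → P ≈ₚ Q → Q ≈ₚ R → P ≈ₚ R
    transₚ ∞≈∞          ∞≈∞            = ∞≈∞
    transₚ (affine p q) (affine p′ q′) = affine (trans p p′) (trans q q′)

module _ (F : HeytingField c ℓ₁ ℓ₂) where
  open HeytingField F
  open CommutativeRing (fieldRing F)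
    using (ring; semiring; +-commutativeMonoid)
  open HCRProperties heytingCommutativeRing
    using (x#0y#0→xy#0; 1#0; #-congʳ; x-0≈x; invertibleʳ⇒#)
  open RingProperties ring
    using (-1*x≈-x; -‿distribʳ-*; -‿involutive; -0#≈0#; +-cancelˡ; +-inverseʳ-unique)
  open Mult semiring using (_×_; ×-congʳ; ×1-homo-*; ×-assoc-*)
  open Exp semiring using (_^_; ^-congˡ)
  open ≈-Reasoning setoid

  -- Translation by 1 permutes F, so the sum of all elements of F equals
  -- itself plus n · 1.
  card×1≈0 : ∀ {n} → HasCardinality setoid n → n × 1# ≈ 0#
  card×1≈0 {n} #F = sym (+-cancelˡ (sum from) _ _ (begin
    sum from + 0#                  ≈⟨ +-identityʳ _ ⟩
    sum from                       ≈⟨ sum-permute from shift ⟩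
    sum (from ∘ (shift ⟨$⟩ʳ_))     ≈⟨ sum-cong-≋ (λ i → strictlyInverseʳ (from i + 1#)) ⟩
    sum (λ i → from i + 1#)        ≈⟨ ∑-distrib-+ from (λ _ → 1#) ⟩
    sum from + sum {n} (λ _ → 1#)  ≈⟨ +-congˡ (sum-replicate n) ⟩
    sum from + n × 1#              ∎))
    where
    open Inverse #F using (to; from; to-cong; strictlyInverseˡ; strictlyInverseʳ)
    open Sum +-commutativeMonoid using (sum; sum-permute; sum-cong-≋; ∑-distrib-+; sum-replicate)

    cancel : ∀ x y z → y + z ≈ 0# → x + y + z ≈ x
    cancel x y z y+z≈0 = trans (+-assoc x y z) (trans (+-congˡ y+z≈0) (+-identityʳ x))

    roundTrip : ∀ y z → y + z ≈ 0# → ∀ i → to (from (to (from i + y)) + z) ≡ i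
    roundTrip y z y+z≈0 i = ≡.trans
      (to-cong (trans (+-congʳ (strictlyInverseʳ (from i + y))) (cancel (from i) y z y+z≈0)))
      (strictlyInverseˡ i)

    shift : Permutation′ n
    shift = permutation (λ i → to (from i + 1#)) (λ i → to (from i - 1#))
      (roundTrip (- 1#) 1# (-‿inverseˡ 1#)) (roundTrip 1# (- 1#) (-‿inverseʳ 1#))

  private
    3^d-odd : ∀ d → ∃[ k ] 3 ℕ.^ d ≡ 1 ℕ.+ 2 ℕ.* k
    3^d-odd zero    = 0 , ≡.refl
    3^d-odd (suc d) with 3^d-odd d
    ... | k , eq = 1 ℕ.+ 3 ℕ.* k , ≡.trans (≡.cong (3 ℕ.*_) eq)
      (solve 1 (λ k → con 3 :* (con 1 :+ con 2 :* k) :=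
                      con 1 :+ con 2 :* (con 1 :+ con 3 :* k)) ≡.refl k)
      where open +-*-Solver

  2#0 : ∀ d → HasCardinality setoid (3 ℕ.^ d) → 2 × 1# # 0#
  2#0 d #F with 3^d-odd d
  ... | k , eq = invertibleʳ⇒# (- (k × 1#) , (begin
    (2 × 1# - 0#) * - (k × 1#)  ≈⟨ *-congʳ (x-0≈x _) ⟩
    2 × 1# * - (k × 1#)         ≈⟨ -‿distribʳ-* _ _ ⟨
    - (2 × 1# * k × 1#)         ≈⟨ -‿cong (×1-homo-* 2 k) ⟨
    - ((2 ℕ.* k) × 1#)          ≈⟨ -‿cong (+-inverseʳ-unique 1# _ odd×1≈0) ⟩
    - - 1#                      ≈⟨ -‿involutive 1# ⟩
    1#                          ∎))
    where
    odd×1≈0 : (1 ℕ.+ 2 ℕ.* k) × 1# ≈ 0#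
    odd×1≈0 = ≡.subst (λ n → n × 1# ≈ 0#) eq (card×1≈0 #F)

  y²=x³+x : WeierstrassCurve F
  y²=x³+x = record { a₁ = 0# ; a₂ = 0# ; a₃ = 0# ; a₄ = 1# ; a₆ = 0# }

  E : ∀ d → HasCardinality setoid (3 ℕ.^ d) → EllipticCurve F
  E d #F = record { weierstrassCurve = y²=x³+x ; Δ#0 = #-congʳ (sym Δ≈-2⁶) -2⁶#0 }
    where
    open WeierstrassCurve y²=x³+x

    two : Carrier
    two = 2 × 1#

    -2⁶ : Carrier
    -2⁶ = - 1# * (two * (two * two) * (two * (two * two)))

    -1#0 : - 1# # 0#
    -1#0 = invertibleʳ⇒# (- 1# , (begin
      (- 1# - 0#) * - 1#  ≈⟨ *-congʳ (x-0≈x _) ⟩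
      - 1# * - 1#         ≈⟨ -1*x≈-x _ ⟩
      - - 1#              ≈⟨ -‿involutive 1# ⟩
      1#                  ∎))

    -2⁶#0 : -2⁶ # 0#
    -2⁶#0 = x#0y#0→xy#0 -1#0 (x#0y#0→xy#0 8#0 8#0)
      where
      t = 2#0 d #F
      8#0 = x#0y#0→xy#0 t (x#0y#0→xy#0 t t)

    n×0≈0 : ∀ n {x} → x ≈ 0# → n × x ≈ 0#
    n×0≈0 zero    x≈0 = refl
    n×0≈0 (suc n) x≈0 = trans (+-cong x≈0 (n×0≈0 n x≈0)) (+-identityˡ 0#)

    0*≈0 : ∀ {x y} → x ≈ 0# → x * y ≈ 0#
    0*≈0 x≈0 = trans (*-congʳ x≈0) (zeroˡ _)

    0+0≈0 : ∀ {x y} → x ≈ 0# → y ≈ 0# → x + y ≈ 0#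
    0+0≈0 x≈0 y≈0 = trans (+-cong x≈0 y≈0) (+-identityˡ 0#)

    -0≈0 : ∀ {x} → x ≈ 0# → - x ≈ 0#
    -0≈0 x≈0 = trans (-‿cong x≈0) -0#≈0#

    b₂≈0 : b₂ ≈ 0#
    b₂≈0 = 0+0≈0 (zeroˡ _) (n×0≈0 4 refl)

    b₆≈0 : b₆ ≈ 0#
    b₆≈0 = 0+0≈0 (zeroˡ _) (n×0≈0 4 refl)

    b₄≈two : b₄ ≈ two
    b₄≈two = trans (+-congˡ (zeroˡ _)) (+-identityʳ _)

    cube : 8 × (b₄ ^ 3) ≈ two * (two * two) * (two * (two * two))
    cube = begin
      8 × (b₄ ^ 3)                   ≈⟨ ×-congʳ 8 (^-congˡ 3 b₄≈two) ⟩
      8 × (two ^ 3)                  ≈⟨ ×-congʳ 8 (*-identityˡ _) ⟨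
      8 × (1# * two ^ 3)             ≈⟨ ×-assoc-* 8 1# _ ⟨
      8 × 1# * two ^ 3               ≈⟨ *-cong (trans (×1-homo-* 2 4) (*-congˡ (×1-homo-* 2 2)))
                                               (*-congˡ (*-congˡ (*-identityʳ two))) ⟩
      two * (two * two) * (two * (two * two)) ∎

    Δ≈-2⁶ : Δ ≈ -2⁶
    Δ≈-2⁶ = begin
      Δ                          ≈⟨ +-cong
        (+-cong (+-congʳ (-0≈0 (0*≈0 (0*≈0 b₂≈0)))) (-0≈0 (n×0≈0 27 (0*≈0 b₆≈0))))
        (n×0≈0 9 (0*≈0 (0*≈0 b₂≈0))) ⟩
      0# - 8 × (b₄ ^ 3) + 0# + 0#  ≈⟨ +-identityʳ _ ⟩
      0# - 8 × (b₄ ^ 3) + 0#       ≈⟨ +-identityʳ _ ⟩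
      0# - 8 × (b₄ ^ 3)            ≈⟨ +-identityˡ _ ⟩
      - (8 × (b₄ ^ 3))             ≈⟨ -‿cong cube ⟩
      - (two * (two * two) * (two * (two * two))) ≈⟨ -1*x≈-x _ ⟨
      -2⁶                        ∎

{-# OPTIONS --safe #-}

-- The map x ↦ x³ + x is a bijection of 𝔽_q, so every y is the ordinate of exactly
-- one affine point. Indeed ψ x = - x³ is additive in characteristic 3, and
-- ψᵈ x = - x^q = - x for odd d by Fermat; so the geometric sum 1 + ψ + ⋯ + ψᵈ⁻¹
-- inverts 1 - ψ, which is x ↦ x³ + x, up to the factor 1 - ψᵈ = 2 = - 1.
module Submission where

open import Algebra using (AbelianGroup; CommutativeRing)
open import Algebra.Apartness using (HeytingField)
open import Algebra.Morphism.Structures using (module GroupMorphisms)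
open import Data.Empty using (⊥-elim)
open import Data.Fin using (Fin; zero; suc; punchIn)
open import Data.Fin.Permutation using (Permutation′; permutation; remove; punchIn-permute; _⟨$⟩ʳ_)
open import Data.Fin.Properties using (punchInᵢ≢i; +↔⊎)
open import Data.Nat using (ℕ; zero; suc; _+_; _^_)
import Data.Nat as ℕ
open import Data.Nat.Divisibility using (_∣_; _∣0; ∣-refl; ∣m∣n⇒∣m+n)
open import Data.Nat.GeneralisedArithmetic using (fold)
import Data.Nat.Properties as ℕ
open import Data.Product using (_,_; proj₁; proj₂)
open import Data.Sum using (_⊎_; inj₁; inj₂)
open import Data.Sum.Function.Setoid using (_⊎-inverse_)
open import Data.Sum.Relation.Binary.Pointwise using (_⊎ₛ_; inj₁; inj₂; Pointwise-≡↔≡)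
open import Function using (Inverse; _∘_)
import Function.Construct.Composition as Composition
import Function.Construct.Identity as Identity
import Function.Construct.Symmetry as Symmetry
open import Relation.Binary.PropositionalEquality as ≡ using (_≡_)
open import Relation.Nullary using (¬_)
import Algebra.Apartness.Properties.HeytingCommutativeRing as HCRProperties
import Algebra.Properties.AbelianGroup as AbelianGroupProperties
import Algebra.Properties.CommutativeMonoid.Sum as Sum
import Algebra.Properties.CommutativeSemigroup as CommutativeSemigroupProperties
import Algebra.Properties.Ring as RingProperties
import Algebra.Properties.Semiring.Exp as Exp
import Algebra.Properties.Semiring.Mult as Mult
import Algebra.Solver.Ring.NaturalCoefficients.Default as SemiringSolver
import Relation.Binary.Reasoning.Setoid as ≈-Reasoning
open import Defs

-- Geometric sums of an endomorphism of an abelian group.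

module _ {a ℓ} (G : AbelianGroup a ℓ) where
  open AbelianGroup G
  open GroupMorphisms rawGroup rawGroup using (IsGroupHomomorphism; module IsGroupHomomorphism)

  module GeometricSum {ψ : Carrier → Carrier} (ψ-hom : IsGroupHomomorphism ψ) where

    open IsGroupHomomorphism ψ-hom using (⟦⟧-cong; homo; ε-homo; ⁻¹-homo)
    open AbelianGroupProperties G using (⁻¹-∙-comm)
    open CommutativeSemigroupProperties commutativeSemigroup using (interchange)
    open ≈-Reasoning setoid

    geometricSum : ℕ → Carrier → Carrier
    geometricSum zero    x = ε
    geometricSum (suc k) x = x ∙ ψ (geometricSum k x)

    geometricSum-cong : ∀ k {x y} → x ≈ y → geometricSum k x ≈ geometricSum k y
    geometricSum-cong zero    x≈y = refl
    geometricSum-cong (suc k) x≈y = ∙-cong x≈y (⟦⟧-cong (geometricSum-cong k x≈y))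

    ψ-homo-difference : ∀ x y → ψ (x - y) ≈ ψ x - ψ y
    ψ-homo-difference x y = trans (homo x (y ⁻¹)) (∙-congˡ (⁻¹-homo y))

    telescope : ∀ x y z → (x - y) ∙ (y - z) ≈ x - z
    telescope x y z = begin
      (x - y) ∙ (y - z)       ≈⟨ assoc x (y ⁻¹) (y - z) ⟩
      x ∙ (y ⁻¹ ∙ (y - z))    ≈⟨ ∙-congˡ (assoc (y ⁻¹) y (z ⁻¹)) ⟨
      x ∙ (y ⁻¹ ∙ y ∙ z ⁻¹)   ≈⟨ ∙-congˡ (∙-congʳ (inverseˡ y)) ⟩
      x ∙ (ε ∙ z ⁻¹)          ≈⟨ ∙-congˡ (identityˡ (z ⁻¹)) ⟩
      x - z                   ∎

    -- The sum telescopes: by induction and additivity of `ψ`, each new term `x - ψ x` cancels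
    -- against the leading `ψ x` of the shifted remainder.
    geometricSum-difference : ∀ k x → geometricSum k (x - ψ x) ≈ x - fold x ψ k
    geometricSum-difference zero    x = sym (inverseʳ x)
    geometricSum-difference (suc k) x = begin
      (x - ψ x) ∙ ψ (geometricSum k (x - ψ x))  ≈⟨ ∙-congˡ (⟦⟧-cong (geometricSum-difference k x)) ⟩
      (x - ψ x) ∙ ψ (x - fold x ψ k)            ≈⟨ ∙-congˡ (ψ-homo-difference x _) ⟩
      (x - ψ x) ∙ (ψ x - ψ (fold x ψ k))        ≈⟨ telescope x (ψ x) _ ⟩
      x - ψ (fold x ψ k)                        ∎

    -- The geometric sum is a polynomial in `ψ`, so it commutes with `1 - ψ`; this reduces the claim
    -- to the telescoping sum and makes the inverse two-sided.
    difference-geometricSum : ∀ k x → geometricSum k x - ψ (geometricSum k x) ≈ x - fold x ψ k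
    difference-geometricSum k x = trans (sym (commute k)) (geometricSum-difference k x)
      where
      commute : ∀ k → geometricSum k (x - ψ x) ≈ geometricSum k x - ψ (geometricSum k x)
      commute zero    = begin
        ε                ≈⟨ inverseʳ (ψ ε) ⟨
        ψ ε - ψ ε        ≈⟨ ∙-congʳ ε-homo ⟩
        ε - ψ ε          ∎
      commute (suc k) = begin
        (x - ψ x) ∙ ψ (geometricSum k (x - ψ x))  ≈⟨ ∙-congˡ (⟦⟧-cong (commute k)) ⟩
        (x - ψ x) ∙ ψ (s - ψ s)                   ≈⟨ ∙-congˡ (ψ-homo-difference s (ψ s)) ⟩
        (x - ψ x) ∙ (ψ s - ψ (ψ s))               ≈⟨ interchange x _ (ψ s) _ ⟩
        (x ∙ ψ s) ∙ (ψ x ⁻¹ ∙ ψ (ψ s) ⁻¹)         ≈⟨ ∙-congˡ (⁻¹-∙-comm (ψ x) _) ⟩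
        (x ∙ ψ s) - (ψ x ∙ ψ (ψ s))               ≈⟨ ∙-congˡ (⁻¹-cong (homo x (ψ s))) ⟨
        (x ∙ ψ s) - ψ (x ∙ ψ s)                   ∎
        where s = geometricSum k x

-- Fermat's little theorem in a finite field.

module FiniteField {c ℓ₁ ℓ₂} (F : HeytingField c ℓ₁ ℓ₂) where
  open HeytingField F
    renaming (_+_ to _⊕_) using
    ( Carrier; _≈_; _#_; _*_; -_; 0#; 1#; _-_; setoid; heytingCommutativeRing
    ; tight; #⇒invertible; refl; sym; trans
    ; *-congˡ; *-congʳ; *-assoc; *-comm; *-identityˡ; *-identityʳ; zeroˡ; zeroʳ
    ; +-congˡ; -‿cong; -‿inverseˡ; +-identityʳ
    )
  open CommutativeRing (fieldRing F)
    using (ring; semiring; commutativeSemiring; *-commutativeMonoid; +-abelianGroup)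
  open GroupMorphisms (AbelianGroup.rawGroup +-abelianGroup) (AbelianGroup.rawGroup +-abelianGroup)
    using (IsGroupHomomorphism)
  open HCRProperties heytingCommutativeRing using (x#0y#0→xy#0; 1#0; x-0≈x)
  open RingProperties ring
    using ([y-z]x≈yx-zx; x∙y⁻¹≈ε⇒x≈y; x≈y⇒x∙y⁻¹≈ε; -‿involutive; -0#≈0#; +-inverseˡ-unique; -‿+-comm)
  open Mult semiring using (_×_; ×-congʳ; ×1-homo-*; ×-assoc-*)
  open Exp semiring using (^-congˡ; ^-assocʳ) renaming (_^_ to _^ᶠ_)
  open Sum *-commutativeMonoid
    using (sum-permute; sum-cong-≋; sum-replicate)
    renaming (sum to product; ∑-distrib-+ to ∏-distrib-*)
  open ≈-Reasoning setoid

  ¬#⇒≈ : ∀ {x y} → ¬ (x # y) → x ≈ y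
  ¬#⇒≈ {x} {y} = proj₁ (tight x y)

  ≈⇒¬# : ∀ {x y} → x ≈ y → ¬ (x # y)
  ≈⇒¬# {x} {y} = proj₂ (tight x y)

  -- Tightness makes equality the negation of apartness, so a refutation suffices: two factors apart
  -- from zero have a product apart from zero.
  x*y≈0∧y≉0⇒x≈0 : ∀ {x y} → x * y ≈ 0# → ¬ (y ≈ 0#) → x ≈ 0#
  x*y≈0∧y≉0⇒x≈0 xy≈0 y≉0 = ¬#⇒≈ λ x#0 → y≉0 (¬#⇒≈ λ y#0 →
    ≈⇒¬# xy≈0 (x#0y#0→xy#0 x#0 y#0))

  ^-#0 : ∀ {x} n → x # 0# → x ^ᶠ n # 0#
  ^-#0 zero    x#0 = 1#0
  ^-#0 (suc n) x#0 = x#0y#0→xy#0 x#0 (^-#0 n x#0)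

  product≉0 : ∀ {n} (t : Fin n → Carrier) → (∀ i → ¬ (t i ≈ 0#)) → ¬ (product t ≈ 0#)
  product≉0 {zero}  t t≉0 1≈0 = ≈⇒¬# 1≈0 1#0
  product≉0 {suc n} t t≉0 p≈0 = t≉0 zero
    (x*y≈0∧y≉0⇒x≈0 p≈0 (product≉0 (t ∘ suc) (t≉0 ∘ suc)))

  -- Multiplication by x permutes the nonzero elements, so the product of
  -- these is unchanged when multiplied by xⁿ.
  unit^n≈1 : ∀ {n x x⁻¹} → HasCardinality setoid (suc n) → x * x⁻¹ ≈ 1# → x ^ᶠ n ≈ 1#
  unit^n≈1 {n} {x} {x⁻¹} #F xx⁻¹≈1 = x∙y⁻¹≈ε⇒x≈y _ _ (x*y≈0∧y≉0⇒x≈0 (begin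
    (x ^ᶠ n - 1#) * ∏units            ≈⟨ [y-z]x≈yx-zx ∏units (x ^ᶠ n) 1# ⟩
    x ^ᶠ n * ∏units - 1# * ∏units     ≈⟨ x≈y⇒x∙y⁻¹≈ε (trans scaled (sym (*-identityˡ ∏units))) ⟩
    0#                                ∎)
    (product≉0 units units≉0))
    where
    open Inverse #F using (to; from; to-cong; strictlyInverseˡ; strictlyInverseʳ)

    i₀ : Fin (suc n)
    i₀ = to 0#

    units : Fin n → Carrier
    units = from ∘ punchIn i₀

    ∏units : Carrier
    ∏units = product units

    units≉0 : ∀ j → ¬ (units j ≈ 0#)
    units≉0 j u≈0 = punchInᵢ≢i i₀ j (≡.trans (≡.sym (strictlyInverseˡ _)) (to-cong u≈0))

    roundTrip : ∀ y z → y * z ≈ 1# → ∀ i → to (y * from (to (z * from i))) ≡ i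
    roundTrip y z yz≈1 i = ≡.trans
      (to-cong (begin
        y * from (to (z * from i))  ≈⟨ *-congˡ (strictlyInverseʳ _) ⟩
        y * (z * from i)            ≈⟨ *-assoc y z _ ⟨
        y * z * from i              ≈⟨ *-congʳ yz≈1 ⟩
        1# * from i                 ≈⟨ *-identityˡ _ ⟩
        from i                      ∎))
      (strictlyInverseˡ i)

    scale : Permutation′ (suc n)
    scale = permutation (λ i → to (x * from i)) (λ i → to (x⁻¹ * from i))
      (roundTrip x x⁻¹ xx⁻¹≈1) (roundTrip x⁻¹ x (trans (*-comm x⁻¹ x) xx⁻¹≈1))

    scale-fixes-i₀ : scale ⟨$⟩ʳ i₀ ≡ i₀
    scale-fixes-i₀ = to-cong (trans (*-congˡ (strictlyInverseʳ 0#)) (zeroʳ x))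

    scaleUnits : Permutation′ n
    scaleUnits = remove i₀ scale

    units-scaleUnits : ∀ j → units (scaleUnits ⟨$⟩ʳ j) ≈ x * units j
    units-scaleUnits j = begin
      from (punchIn i₀ (scaleUnits ⟨$⟩ʳ j))
        ≡⟨ ≡.cong (λ i → from (punchIn i (scaleUnits ⟨$⟩ʳ j))) scale-fixes-i₀ ⟨
      -- `punchIn-permute` describes the restricted permutation relative to the image of the removed
      -- index, hence the detour through `scale ⟨$⟩ʳ i₀`, which equals `i₀`.
      from (punchIn (scale ⟨$⟩ʳ i₀) (scaleUnits ⟨$⟩ʳ j))
        ≡⟨ ≡.cong from (punchIn-permute scale i₀ j) ⟨
      from (to (x * units j))
        ≈⟨ strictlyInverseʳ _ ⟩
      x * units j ∎

    scaled : x ^ᶠ n * ∏units ≈ ∏units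
    scaled = begin
      x ^ᶠ n * ∏units                        ≈⟨ *-congʳ (sum-replicate n) ⟨
      product {n} (λ _ → x) * ∏units         ≈⟨ ∏-distrib-* (λ _ → x) units ⟨
      product (λ j → x * units j)            ≈⟨ sum-cong-≋ units-scaleUnits ⟨
      product (units ∘ (scaleUnits ⟨$⟩ʳ_))   ≈⟨ sum-permute units scaleUnits ⟨
      ∏units                                 ∎

  fermat : ∀ {n} → HasCardinality setoid n → ∀ x → x ^ᶠ n ≈ x
  fermat {zero}  #F x with () ← Inverse.to #F 0#
  -- The cases of `x` zero or a unit are combined inside a refutation: if `xⁿ#x`, the unit case
  -- excludes `x # 0#`, so `x ≈ 0#`, and the zero case contradicts `xⁿ#x`.
  fermat {suc n} #F x = ¬#⇒≈ λ xⁿ#x →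
    ≈⇒¬# (zeroCase (¬#⇒≈ λ x#0 → ≈⇒¬# (unitCase x#0) xⁿ#x)) xⁿ#x
    where
    zeroCase : x ≈ 0# → x ^ᶠ suc n ≈ x
    zeroCase x≈0 = trans (*-congʳ x≈0) (trans (zeroˡ _) (sym x≈0))

    unitCase : x # 0# → x ^ᶠ suc n ≈ x
    unitCase x#0 with #⇒invertible x#0
    ... | x⁻¹ , _ , xx⁻¹≈1 = trans
      -- The inverse obtained from `x # 0#` is an inverse of `x - 0#`.
      (*-congˡ (unit^n≈1 #F (trans (*-congʳ (sym (x-0≈x x))) xx⁻¹≈1)))
      (*-identityʳ x)

  -- The characteristic, read off from the cardinality.

  [m^d]×1≈[m×1]^d : ∀ m d → (m ^ d) × 1# ≈ (m × 1#) ^ᶠ d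
  [m^d]×1≈[m×1]^d m zero    = +-identityʳ 1#
  [m^d]×1≈[m×1]^d m (suc d) = trans (×1-homo-* m (m ^ d)) (*-congˡ ([m^d]×1≈[m×1]^d m d))

  -- The cardinality annihilates `1#`, so the `d`-th power of `m × 1#` vanishes, and a field has no
  -- nonzero nilpotents.
  card≡m^d⇒m×x≈0 : ∀ {m d} → HasCardinality setoid (m ^ d) → ∀ x → m × x ≈ 0#
  card≡m^d⇒m×x≈0 {m} {d} #F x = begin
    m × x           ≈⟨ ×-congʳ m (*-identityˡ x) ⟨
    m × (1# * x)    ≈⟨ ×-assoc-* m 1# x ⟨
    m × 1# * x      ≈⟨ *-congʳ m×1≈0 ⟩
    0# * x          ≈⟨ zeroˡ x ⟩
    0#              ∎
    where
    m×1≈0 : m × 1# ≈ 0#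
    m×1≈0 = ¬#⇒≈ λ m#0 →
      ≈⇒¬# (trans (sym ([m^d]×1≈[m×1]^d m d)) (card×1≈0 F #F)) (^-#0 d m#0)

  -- The negated Frobenius map in characteristic 3.

  module Characteristic3 (3×≈0 : ∀ x → 3 × x ≈ 0#) where

    -- The sign is chosen so that `x - ψ x` is the right-hand side of the curve equation.
    ψ : Carrier → Carrier
    ψ x = - (x ^ᶠ 3)

    [x+y]³≈x³+y³ : ∀ x y → (x ⊕ y) ^ᶠ 3 ≈ x ^ᶠ 3 ⊕ y ^ᶠ 3
    [x+y]³≈x³+y³ x y = begin
      (x ⊕ y) ^ᶠ 3                                       ≈⟨ expand x y ⟩
      x ^ᶠ 3 ⊕ y ^ᶠ 3 ⊕ 3 × (x * x * y ⊕ x * y * y)      ≈⟨ +-congˡ (3×≈0 _) ⟩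
      x ^ᶠ 3 ⊕ y ^ᶠ 3 ⊕ 0#                               ≈⟨ +-identityʳ _ ⟩
      x ^ᶠ 3 ⊕ y ^ᶠ 3                                    ∎
      where
      expand : ∀ x y → (x ⊕ y) ^ᶠ 3 ≈ x ^ᶠ 3 ⊕ y ^ᶠ 3 ⊕ 3 × (x * x * y ⊕ x * y * y)
      expand = solve 2 (λ x y →
        -- Powers and multiples are spelled out as `_^ᶠ_` and `_×_` unfold, so that the solved
        -- identity is the stated one by computation.
        let cube z = z :* (z :* (z :* con 1)); w = x :* x :* y :+ x :* y :* y in
        cube (x :+ y) := cube x :+ cube y :+ (w :+ (w :+ (w :+ con 0)))) refl
        where open SemiringSolver commutativeSemiring

    ψ-homo : ∀ x y → ψ (x ⊕ y) ≈ ψ x ⊕ ψ y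
    ψ-homo x y = trans (-‿cong ([x+y]³≈x³+y³ x y)) (sym (-‿+-comm _ _))

    ψ-cong : ∀ {x y} → x ≈ y → ψ x ≈ ψ y
    ψ-cong x≈y = -‿cong (^-congˡ 3 x≈y)

    ψ-0 : ψ 0# ≈ 0#
    ψ-0 = trans (-‿cong (zeroˡ _)) -0#≈0#

    ψ-neg : ∀ x → ψ (- x) ≈ - ψ x
    ψ-neg x = +-inverseˡ-unique _ _ (begin
      ψ (- x) ⊕ ψ x   ≈⟨ ψ-homo (- x) x ⟨
      ψ (- x ⊕ x)     ≈⟨ ψ-cong (-‿inverseˡ x) ⟩
      ψ 0#            ≈⟨ ψ-0 ⟩
      0#              ∎)

    ψ-isGroupHomomorphism : IsGroupHomomorphism ψ
    ψ-isGroupHomomorphism = record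
      { isMonoidHomomorphism = record
        { isMagmaHomomorphism = record
          { isRelHomomorphism = record { cong = ψ-cong }
          ; homo = ψ-homo
          }
        ; ε-homo = ψ-0
        }
      ; ⁻¹-homo = ψ-neg
      }

    open GeometricSum +-abelianGroup ψ-isGroupHomomorphism

    -- Induction in steps of two keeps the parity: two applications of `ψ` cancel their signs and
    -- raise to the ninth power.
    fold-ψ-odd : ∀ x k → ¬ (2 ∣ k) → fold x ψ k ≈ - (x ^ᶠ (3 ^ k))
    fold-ψ-odd x 0             odd = ⊥-elim (odd (2 ∣0))
    fold-ψ-odd x 1             odd = refl
    fold-ψ-odd x (suc (suc k)) odd = begin
      ψ (ψ (fold x ψ k))
        ≈⟨ ψ-cong (ψ-cong (fold-ψ-odd x k (odd ∘ ∣m∣n⇒∣m+n ∣-refl))) ⟩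
      ψ (ψ (- (x ^ᶠ 3ᵏ)))
        ≈⟨ ψ-cong (trans (ψ-neg _) (-‿involutive _)) ⟩
      - (((x ^ᶠ 3ᵏ) ^ᶠ 3) ^ᶠ 3)
        ≈⟨ -‿cong (trans (^-congˡ 3 (^-assocʳ x 3ᵏ 3)) (^-assocʳ x (3ᵏ ℕ.* 3) 3)) ⟩
      - (x ^ᶠ (3ᵏ ℕ.* 3 ℕ.* 3))
        ≡⟨ ≡.cong (λ n → - (x ^ᶠ n))
             (≡.trans (ℕ.*-comm (3ᵏ ℕ.* 3) 3) (≡.cong (3 ℕ.*_) (ℕ.*-comm 3ᵏ 3))) ⟩
      - (x ^ᶠ (3 ^ suc (suc k))) ∎
      where 3ᵏ = 3 ^ k

    -- Inverting the cubic and counting points.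

    module _ {d} (odd : ¬ (2 ∣ d)) (#F : HasCardinality setoid (3 ^ d)) where

      -- By Fermat the `d`-fold iterate of `ψ` negates, so the left side is minus twice `x`, which
      -- is `x` in characteristic 3.
      -x-ψᵈ[-x]≈x : ∀ x → - x - fold (- x) ψ d ≈ x
      -x-ψᵈ[-x]≈x x = begin
        - x - fold (- x) ψ d          ≈⟨ +-congˡ (-‿cong (fold-ψ-odd (- x) d odd)) ⟩
        - x - - ((- x) ^ᶠ (3 ^ d))    ≈⟨ +-congˡ (-‿involutive _) ⟩
        - x ⊕ (- x) ^ᶠ (3 ^ d)        ≈⟨ +-congˡ (fermat #F (- x)) ⟩
        - x - x                       ≈⟨ -‿+-comm x x ⟩
        - (x ⊕ x)                     ≈⟨ +-inverseˡ-unique x (x ⊕ x) x+[x+x]≈0 ⟨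
        x                             ∎
        where
        x+[x+x]≈0 : x ⊕ (x ⊕ x) ≈ 0#
        x+[x+x]≈0 = trans (+-congˡ (+-congˡ (sym (+-identityʳ x)))) (3×≈0 x)

      -- The geometric sum inverts `1 - ψ` up to the factor `- 1#`; negating the argument absorbs
      -- this factor.
      root : Carrier → Carrier
      root z = geometricSum d (- z)

      root-cong : ∀ {y z} → y ≈ z → root y ≈ root z
      root-cong y≈z = geometricSum-cong d (-‿cong y≈z)

      root-ψ[root]≈ : ∀ z → root z - ψ (root z) ≈ z
      root-ψ[root]≈ z = trans (difference-geometricSum d (- z)) (-x-ψᵈ[-x]≈x z)

      root[x-ψx]≈x : ∀ x → root (x - ψ x) ≈ x
      root[x-ψx]≈x x = begin
        geometricSum d (- (x - ψ x))    ≈⟨ geometricSum-cong d (-‿+-comm x (- ψ x)) ⟨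
        geometricSum d (- x - - ψ x)    ≈⟨ geometricSum-cong d (+-congˡ (-‿cong (ψ-neg x))) ⟨
        geometricSum d (- x - ψ (- x))  ≈⟨ geometricSum-difference d (- x) ⟩
        - x - fold (- x) ψ d            ≈⟨ -x-ψᵈ[-x]≈x x ⟩
        x                               ∎

      open WeierstrassCurve (y²=x³+x F) using (OnCurve)

      private
        lhs≈ : ∀ x y → y ^ᶠ 2 ⊕ 0# * x * y ⊕ 0# * y ≈ y ^ᶠ 2
        lhs≈ = solve 2 (λ x y →
          y :* (y :* con 1) :+ con 0 :* x :* y :+ con 0 :* y := y :* (y :* con 1)) refl
          where open SemiringSolver commutativeSemiring

        rhs≈ : ∀ x → x ^ᶠ 3 ⊕ 0# * x ^ᶠ 2 ⊕ 1# * x ⊕ 0# ≈ x - ψ x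
        rhs≈ x = trans
          (solve 1 (λ x →
            let x² = x :* (x :* con 1) in
            x :* x² :+ con 0 :* x² :+ con 1 :* x :+ con 0 := x :+ x :* x²) refl x)
          -- Here `- ψ x` is a double negation of the cube, which a semiring solver cannot express.
          (+-congˡ (sym (-‿involutive _)))
          where open SemiringSolver commutativeSemiring

      onCurve⇒ : ∀ {x y} → OnCurve x y → y ^ᶠ 2 ≈ x - ψ x
      onCurve⇒ {x} {y} eq = trans (sym (lhs≈ x y)) (trans eq (rhs≈ x))

      onCurve⇐ : ∀ {x y} → y ^ᶠ 2 ≈ x - ψ x → OnCurve x y
      onCurve⇐ {x} {y} eq = trans (lhs≈ x y) (trans eq (sym (rhs≈ x)))

      -- An affine point is determined by its ordinate, which may be arbitrary, because the cubic in
      -- the abscissa is bijective; `Fin 1` accounts for the point at infinity.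
      points↔ordinates : Inverse (pointSetoid (E F d #F)) (setoid ⊎ₛ ≡.setoid (Fin 1))
      points↔ordinates = record
        { to        = to
        ; from      = from
        ; to-cong   = λ { ∞≈∞ → inj₂ ≡.refl ; (affine _ y≈y′) → inj₁ y≈y′ }
        ; from-cong = λ { (inj₁ y≈y′) → affine (root-cong (^-congˡ 2 y≈y′)) y≈y′ ; (inj₂ _) → ∞≈∞ }
        ; inverse   = (λ { {inj₁ _} (affine _ y≈y′) → inj₁ y≈y′ ; {inj₂ zero} ∞≈∞ → inj₂ ≡.refl })
                    , (λ { {∞} (inj₂ _) → ∞≈∞
                         ; {affine x y p} (inj₁ y′≈y) → affine
                             -- The curve equation replaces the squared ordinate by `x - ψ x`, from
                             -- which `root` recovers `x`.
                             (trans (root-cong (trans (^-congˡ 2 y′≈y) (onCurve⇒ p))) (root[x-ψx]≈x x))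
                             y′≈y })
        }
        where
        to : Point (E F d #F) → Carrier ⊎ Fin 1
        to ∞              = inj₂ zero
        to (affine _ y _) = inj₁ y

        from : Carrier ⊎ Fin 1 → Point (E F d #F)
        from (inj₁ y) = affine (root (y ^ᶠ 2)) y (onCurve⇐ (sym (root-ψ[root]≈ (y ^ᶠ 2))))
        from (inj₂ _) = ∞

proposition3p3 : ∀ {c ℓ₁ ℓ₂} (F : HeytingField c ℓ₁ ℓ₂) (d : ℕ) → ¬ (2 ∣ d) →
    (#F : HasCardinality (HeytingField.setoid F) (3 ^ d)) →
    HasCardinality (pointSetoid (E F d #F)) (3 ^ d + 1)
proposition3p3 F d odd #F =
  -- The chain runs from points to field elements plus one, then to `Fin (3 ^ d) ⊎ Fin 1`, and
  -- finally to `Fin (3 ^ d + 1)`.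
  Composition.inverse (points↔ordinates odd #F)
  (Composition.inverse (#F ⊎-inverse Identity.inverse (≡.setoid (Fin 1)))
  (Composition.inverse (Pointwise-≡↔≡ (Fin (3 ^ d)) (Fin 1))
  (Symmetry.inverse +↔⊎)))
  where
  open FiniteField F
  open Characteristic3 (card≡m^d⇒m×x≈0 {3} {d} #F)
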